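{- Let $m(n)$ denote the number of mesosome-avoiding words of length $n$ over the alphabet $\{0,1\}$. For $n \geq 5$, write $n = 4k+i$ with $k$ an integer and $i \in \{0,1,2,3\}$. Then, for all such $n \geq 5$, \begin{align*} m(4k) &= (4k^3 + 15k^2 + 41k - 12)/3,\\ m(4k+1) &= (4k^3 + 18k^2 + 50k)/3,\\ m(4k+2) &= (4k^3 + 21k^2 + 59k + 12)/3,\\ m(4k+3) &= (4k^3 + 24k^2 + 68k + 30)/3, \end{align*} according to whether $i = 0, 1, 2, 3$ respectively.
   Context: Two finite words $x, x'$ are conjugates if there exist (possibly empty) words $u, v$ with $x = uv$ and $x' = vu$. A finite nonempty word $w$ is a mesosome if it is of the form $w = xx'$ where $x'$ is a conjugate of $x$ and $x \neq x'$. A factor of a word is a contiguous sub-block of it. A word avoids mesosomes if none of its factors is a mesosome. -}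

module Defs where

open import Data.Fin.Base using (Fin)
import Data.Fin.Properties as Fin
open import Data.List.Base
  using (List; []; _∷_; _++_; length; filter; allFin; cartesianProductWith)
open import Data.List.Properties using (≡-dec; ∷-injective)
open import Data.List.Membership.Propositional using (_∈_)
open import Data.List.Membership.Propositional.Properties
  using (∈-allFin; ∈-cartesianProductWith⁺; ∈-cartesianProductWith⁻)
open import Data.List.Relation.Binary.Infix.Heterogeneous
  using (Infix; MkView; toView; fromView)
open import Data.List.Relation.Binary.Pointwise using (Pointwise-≡⇒≡; ≡⇒Pointwise-≡)
open import Data.List.Relation.Unary.All using ([])
open import Data.List.Relation.Unary.Any using (here)
open import Data.List.Relation.Unary.Unique.Propositional using (Unique; []; _∷_)
open import Data.List.Relation.Unary.Unique.Propositional.Properties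
  using (allFin⁺; cartesianProductWith⁺)
open import Data.Nat.Base using (ℕ; zero; suc)
open import Data.Product.Base using (∃₂; _×_; _,_)
open import Data.Sum.Base using (_⊎_; inj₁; inj₂)
open import Level using (Level)
open import Relation.Binary.Definitions using (DecidableEquality)
open import Relation.Binary.PropositionalEquality using (_≡_; _≢_; refl; cong)
open import Relation.Nullary.Decidable using (Dec; ¬?; map′; _×-dec_; _⊎-dec_)
open import Relation.Nullary.Negation using (¬_)

private
  variable
    a p : Level
    A : Set a

Conjugate : List A → List A → Set _
Conjugate x x′ = ∃₂ λ u v → x ≡ u ++ v × x′ ≡ v ++ u

Mesosome : List A → Set _
Mesosome w = w ≢ [] × ∃₂ λ x x′ → w ≡ x ++ x′ × Conjugate x x′ × x ≢ x′

Factor : List A → List A → Set _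
Factor = Infix _≡_

AvoidsMesosomes : List A → Set _
AvoidsMesosomes w = ∀ y → Factor y w → ¬ Mesosome y

split? : {P : List A → List A → Set p} → (∀ u v → Dec (P u v)) →
         ∀ w → Dec (∃₂ λ u v → w ≡ u ++ v × P u v)
split? P? [] =
  map′ (λ q → [] , [] , refl , q) (λ { ([] , [] , refl , q) → q }) (P? [] [])
split? {P = P} P? (c ∷ w) =
  map′ to from (P? [] (c ∷ w) ⊎-dec split? (λ u v → P? (c ∷ u) v) w)
  where
  to : P [] (c ∷ w) ⊎ (∃₂ λ u v → w ≡ u ++ v × P (c ∷ u) v) →
       ∃₂ λ u v → c ∷ w ≡ u ++ v × P u v
  to (inj₁ q)                  = [] , c ∷ w , refl , q
  to (inj₂ (u , v , refl , q)) = c ∷ u , v , refl , q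
  from : (∃₂ λ u v → c ∷ w ≡ u ++ v × P u v) →
         P [] (c ∷ w) ⊎ (∃₂ λ u v → w ≡ u ++ v × P (c ∷ u) v)
  from ([]    , _ , refl , q) = inj₁ q
  from (_ ∷ u , v , refl , q) = inj₂ (u , v , refl , q)

module _ {A : Set a} (_≟_ : DecidableEquality A) where

  private
    _≟ʷ_ : DecidableEquality (List A)
    _≟ʷ_ = ≡-dec _≟_

  conjugate? : ∀ x x′ → Dec (Conjugate {A = A} x x′)
  conjugate? x x′ = split? (λ u v → x′ ≟ʷ (v ++ u)) x

  mesosome? : ∀ w → Dec (Mesosome {A = A} w)
  mesosome? w =
    ¬? (w ≟ʷ []) ×-dec split? (λ x x′ → conjugate? x x′ ×-dec ¬? (x ≟ʷ x′)) w

  avoidsMesosomes? : ∀ w → Dec (AvoidsMesosomes {A = A} w)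
  avoidsMesosomes? w =
    map′ to from (¬? (split? (λ _ r → split? (λ y _ → mesosome? y) r) w))
    where
    HasMesosome : Set _
    HasMesosome =
      ∃₂ λ pre r → w ≡ pre ++ r × ∃₂ λ y suf → r ≡ y ++ suf × Mesosome y
    to : ¬ HasMesosome → AvoidsMesosomes w
    to ¬h y f mes with MkView pre {y′} pw suf ← toView f
      with refl ← Pointwise-≡⇒≡ pw =
      ¬h (pre , y′ ++ suf , refl , y′ , suf , refl , mes)
    from : AvoidsMesosomes w → ¬ HasMesosome
    from av (pre , _ , refl , y , suf , refl , mes) =
      av y (fromView (MkView pre (≡⇒Pointwise-≡ refl) suf)) mes

BinaryWord : Set
BinaryWord = List (Fin 2)

words : ℕ → List BinaryWord
words zero    = [] ∷ []
words (suc n) = cartesianProductWith _∷_ (allFin 2) (words n)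

∈-words⁺ : ∀ w → w ∈ words (length w)
∈-words⁺ []      = here refl
∈-words⁺ (c ∷ w) = ∈-cartesianProductWith⁺ _∷_ (∈-allFin c) (∈-words⁺ w)

∈-words⁻ : ∀ n {w} → w ∈ words n → length w ≡ n
∈-words⁻ zero    (here refl) = refl
∈-words⁻ (suc n) w∈
  with _ , _ , _ , w′∈ , refl ← ∈-cartesianProductWith⁻ _∷_ (allFin 2) (words n) w∈ =
  cong suc (∈-words⁻ n w′∈)

words-unique : ∀ n → Unique (words n)
words-unique zero    = [] ∷ []
words-unique (suc n) = cartesianProductWith⁺ _∷_ ∷-injective (allFin⁺ 2) (words-unique n)

m : ℕ → ℕ
m n = length (filter (avoidsMesosomes? Fin._≟_) (words n))

{-# OPTIONS --safe #-}
module Submission where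

-- The words avoiding mesosomes are those with at most two runs, those with run
-- lengths a, b, c where b is odd, those with run lengths a, b, c, d where either
-- b = c = 1, or b and c are odd, a < c and d < b, and the alternating words.
-- Indeed, a letter put in front of a word of this family gives either another
-- member or a word with one of a few explicit mesosomes u v v u as a prefix.
-- Conversely the family is closed under factors, and u v = v u whenever u v v u is
-- a member: with one run or alternating, u v v u has the form s s; three runs are
-- excluded by the parity of the middle one; with two or four runs, the first and
-- last letters differ, so u contains a change of letter, which is impossible for
-- two runs and for four runs leaves none to v, whence a = c or b = d.
-- The numbers of members are convolutions of simple sequences and satisfy
-- recurrences of step 4.

open import Defs
open import Data.Empty using (⊥-elim)
open import Data.Fin.Base using (Fin)
open import Data.Fin.Patterns using (0F; 1F; 2F; 3F; 4F; 5F)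
import Data.Fin.Properties as Fin
open import Data.List.Base
  using (List; []; _∷_; _++_; [_]; _∷ʳ_; length; map; concatMap; filter; replicate; allFin; cartesianProduct)
open import Data.List.Membership.Propositional using (_∈_; lose; find)
open import Data.List.Membership.Propositional.Properties
open import Data.List.Membership.Propositional.Properties.WithK using (unique∧set⇒bag)
open import Data.List.Properties
open import Data.List.Relation.Binary.BagAndSetEquality using (∼bag⇒↭)
open import Data.List.Relation.Binary.Infix.Heterogeneous using (MkView; toView; fromView; there)
open import Data.List.Relation.Binary.Permutation.Propositional.Properties using (↭-length)
open import Data.List.Relation.Binary.Pointwise using (Pointwise-≡⇒≡; ≡⇒Pointwise-≡)
open import Data.List.Relation.Unary.All as All using ([]; _∷_)
import Data.List.Relation.Unary.All.Properties as All
import Data.List.Relation.Unary.AllPairs as AllPairs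
import Data.List.Relation.Unary.AllPairs.Properties as AllPairs
open import Data.List.Relation.Unary.Any using (here; there)
open import Data.List.Relation.Unary.Unique.Propositional using (Unique; []; _∷_)
import Data.List.Relation.Unary.Unique.Propositional.Properties as Unique
open import Data.Nat.Base hiding (_/_)
open import Data.Nat.Properties
open import Data.Nat.Tactic.RingSolver using (solve-∀)
open import Data.Product.Base using (∃; ∃₂; _×_; _,_; proj₁; proj₂; map₂; uncurry)
open import Data.Sum.Base using (_⊎_; inj₁; inj₂)
open import Data.Unit.Base using (⊤; tt)
open import Function.Base using (_∘_; _∋_; case_of_; const)
open import Function.Bundles using (mk⇔)
open import Relation.Binary.PropositionalEquality hiding ([_])
open import Relation.Nullary.Decidable using (yes; no; decidable-stable)
open import Relation.Nullary.Negation using (¬_; contradiction)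

open ≡-Reasoning

private
  variable
    A B : Set

-- Parity and repeated letters

even-or-odd : ∀ n → (∃ λ h → n ≡ h + h) ⊎ (∃ λ h → n ≡ suc (h + h))
even-or-odd zero    = inj₁ (0 , refl)
even-or-odd (suc n) with even-or-odd n
... | inj₁ (h , refl) = inj₂ (h , refl)
... | inj₂ (h , refl) = inj₁ (suc h , cong suc (sym (+-suc h h)))

replicate-+ : ∀ m n {x : A} w →
              replicate (m + n) x ++ w ≡ replicate m x ++ replicate n x ++ w
replicate-+ zero    n w = refl
replicate-+ (suc m) n w = cong (_ ∷_) (replicate-+ m n w)

replicate-∷ : ∀ n {x : A} w → replicate n x ++ x ∷ w ≡ x ∷ replicate n x ++ w
replicate-∷ zero    w = refl
replicate-∷ (suc n) w = cong (_ ∷_) (replicate-∷ n w)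

-- Run lengths are stored minus one, so that every code denotes a word.
decode : A → A → List ℕ → List A
decode x y []       = []
decode x y (a ∷ as) = replicate (suc a) x ++ decode y x as

-- An odd run has an even code, hence the entries `h + h` and `l + l`. The bounds in `four₂` force
-- `h` and `l` to be positive, so it never overlaps with `four₁`; `alt n` adds a new word only for
-- `n ≥ 5`.
data Good : List ℕ → Set where
  nil   : Good []
  one   : ∀ a → Good (a ∷ [])
  two   : ∀ a b → Good (a ∷ b ∷ [])
  three : ∀ a h c → Good (a ∷ h + h ∷ c ∷ [])
  four₁ : ∀ a d → Good (a ∷ 0 ∷ 0 ∷ d ∷ [])
  four₂ : ∀ {a d} h l → a < l + l → d < h + h → Good (a ∷ h + h ∷ l + l ∷ d ∷ [])
  alt   : ∀ n → Good (replicate n 0)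

GoodWord : BinaryWord → Set
GoodWord w = ∃₂ λ x y → x ≢ y × ∃ λ as → Good as × w ≡ decode x y as

-- Words avoiding mesosomes are good

module _ {w : BinaryWord} (av : AvoidsMesosomes w) where

  -- Were `u v` and `v u` different, they would be conjugates forming a mesosome at the front of
  -- `w`. Equality of words is decidable, so excluding this yields the equation itself.
  prefix-commutes : ∀ u v t → w ≡ u ++ v ++ v ++ u ++ t → u ++ v ≡ v ++ u
  prefix-commutes u v t eq = decidable-stable (≡-dec Fin._≟_ (u ++ v) (v ++ u)) λ uv≢vu →
    av ((u ++ v) ++ v ++ u)
       (subst (Factor _) (sym eq′) (fromView (MkView [] (≡⇒Pointwise-≡ refl) t)))
       (nonempty uv≢vu , u ++ v , v ++ u , refl , (u , v , refl , refl) , uv≢vu)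
    where
    eq′ : w ≡ ((u ++ v) ++ v ++ u) ++ t
    eq′ = begin
      w                          ≡⟨ eq ⟩
      u ++ v ++ v ++ u ++ t      ≡⟨ cong (λ z → u ++ v ++ z) (++-assoc v u t) ⟨
      u ++ v ++ (v ++ u) ++ t    ≡⟨ ++-assoc u v _ ⟨
      (u ++ v) ++ (v ++ u) ++ t  ≡⟨ ++-assoc (u ++ v) (v ++ u) t ⟨
      ((u ++ v) ++ v ++ u) ++ t  ∎
    nonempty : u ++ v ≢ v ++ u → (u ++ v) ++ v ++ u ≢ []
    nonempty ne e = ne (trans (++-conicalˡ _ _ e) (sym (++-conicalʳ (u ++ v) _ e)))

  module _ {x y : Fin 2} (x≢y : x ≢ y) where

    -- Take `u = y` and half of the run as `v`; then `u v` and `v u` differ in the first letter.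
    ¬even-run : ∀ h t → w ≢ y ∷ replicate (suc (suc (h + h))) x ++ y ∷ t
    ¬even-run h t refl = x≢y (sym (∷-injectiveˡ
      (prefix-commutes [ y ] (replicate (suc h) x) t (cong (y ∷_) (begin
        replicate (suc (suc (h + h))) x ++ y ∷ t
          ≡⟨ cong (λ k → replicate (suc k) x ++ y ∷ t) (+-suc h h) ⟨
        replicate (suc h + suc h) x ++ y ∷ t
          ≡⟨ replicate-+ (suc h) (suc h) (y ∷ t) ⟩
        replicate (suc h) x ++ replicate (suc h) x ++ y ∷ t ∎)))))

    -- Take as `u` the letter `y` with the run after it, and as `v` half of the long `y` run without
    -- its last letter. That letter and `suc a` of the following `x` form the second `u`, since
    -- `a ≤ c`. Then `u v` and `v u` differ in the second letter.
    ¬third≥first : ∀ a h c t → a ≤ c →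
      w ≢ y ∷ replicate (suc a) x ++ replicate (suc (suc h + suc h)) y ++ replicate (suc c) x ++ t
    ¬third≥first a h c t a≤c refl with e , refl ← m≤n⇒∃[o]m+o≡n a≤c = x≢y (second h
      (prefix-commutes (y ∷ replicate (suc a) x) (replicate (suc h) y) (replicate e x ++ t)
        (cong (λ z → y ∷ replicate (suc a) x ++ z) (begin
          y ∷ replicate (suc h + suc h) y ++ replicate (suc (a + e)) x ++ t
            ≡⟨ cong (λ z → y ∷ replicate (suc h + suc h) y ++ z) (replicate-+ (suc a) e t) ⟩
          y ∷ replicate (suc h + suc h) y ++ rest
            ≡⟨ replicate-∷ (suc h + suc h) rest ⟨
          replicate (suc h + suc h) y ++ y ∷ rest
            ≡⟨ replicate-+ (suc h) (suc h) (y ∷ rest) ⟩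
          replicate (suc h) y ++ replicate (suc h) y ++ y ∷ rest ∎))))
      where
      rest : BinaryWord
      rest = replicate (suc a) x ++ replicate e x ++ t
      second : ∀ h {s r} → y ∷ x ∷ s ≡ replicate (suc h) y ++ y ∷ r → x ≡ y
      second zero    e = ∷-injectiveˡ (∷-injectiveʳ e)
      second (suc h) e = ∷-injectiveˡ (∷-injectiveʳ e)

    -- Here `u` is the first run with one `y`, and `v` is half of the rest of the second run. The
    -- second `u` consists of the third run, which matches the first exactly, and the `y` after it.
    ¬first≡third : ∀ a h c t → a ≡ c →
      w ≢ replicate (suc a) x ++ replicate (suc (suc h + suc h)) y ++ replicate (suc c) x ++ y ∷ t
    ¬first≡third a h _ t refl refl = x≢y (∷-injectiveˡ
      (prefix-commutes (replicate (suc a) x ++ [ y ]) (replicate (suc h) y) t (begin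
        replicate (suc a) x ++ y ∷ replicate (suc h + suc h) y ++ rest
          ≡⟨ ++-assoc (replicate (suc a) x) [ y ] _ ⟨
        (replicate (suc a) x ++ [ y ]) ++ replicate (suc h + suc h) y ++ rest
          ≡⟨ cong ((replicate (suc a) x ++ [ y ]) ++_) (replicate-+ (suc h) (suc h) rest) ⟩
        (replicate (suc a) x ++ [ y ]) ++ replicate (suc h) y ++ replicate (suc h) y ++ rest
          ≡⟨ cong (λ z → (replicate (suc a) x ++ [ y ]) ++ replicate (suc h) y ++ replicate (suc h) y ++ z)
               (++-assoc (replicate (suc a) x) [ y ] t) ⟨
        (replicate (suc a) x ++ [ y ]) ++ replicate (suc h) y ++ replicate (suc h) y ++ (replicate (suc a) x ++ [ y ]) ++ t ∎)))
      where
      rest : BinaryWord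
      rest = replicate (suc a) x ++ y ∷ t

-- Outside the alternating case a longer first run can break only the bound `a < l + l`, and then
-- the first and third runs have become equal.
extend-same : ∀ {x y as} → x ≢ y → Good as →
              AvoidsMesosomes (x ∷ decode x y as) → GoodWord (x ∷ decode x y as)
extend-same x≢y nil av = _ , _ , x≢y , _ , one 0 , refl
extend-same x≢y (one a) av = _ , _ , x≢y , _ , one (suc a) , refl
extend-same x≢y (two a b) av = _ , _ , x≢y , _ , two (suc a) b , refl
extend-same x≢y (three a h c) av = _ , _ , x≢y , _ , three (suc a) h c , refl
extend-same x≢y (four₁ a d) av = _ , _ , x≢y , _ , four₁ (suc a) d , refl
extend-same x≢y (four₂ {a} h l a<2l d<2h) av with m≤n⇒m<n∨m≡n a<2l
... | inj₁ 1+a<2l = _ , _ , x≢y , _ , four₂ h l 1+a<2l d<2h , refl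
extend-same x≢y (four₂ {a} {d} (suc h) l a<2l d<2h) av | inj₂ 1+a≡2l =
  ⊥-elim (¬first≡third av x≢y (suc a) h _ _ 1+a≡2l refl)
extend-same x≢y (alt 0) av = _ , _ , x≢y , _ , one 0 , refl
extend-same x≢y (alt 1) av = _ , _ , x≢y , _ , one 1 , refl
extend-same x≢y (alt 2) av = _ , _ , x≢y , _ , two 1 0 , refl
extend-same x≢y (alt 3) av = _ , _ , x≢y , _ , three 1 0 0 , refl
extend-same x≢y (alt 4) av = _ , _ , x≢y , _ , four₁ 1 0 , refl
-- The word begins with `x x y x y x`, which is `u v v u` for `u = x` and `v = x y`.
extend-same x≢y (alt (suc (suc (suc (suc (suc n)))))) av =
  contradiction (∷-injectiveˡ (∷-injectiveʳ (prefix-commutes av [ _ ] (_ ∷ _ ∷ []) _ refl))) x≢y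

-- The old first run becomes the second one, so it must be odd as soon as another run follows. Apart
-- from the prefix `y x y x y y`, the other bad cases compare either the new run with the third, or
-- the old first run with the old third.
extend-other : ∀ {x y as} → x ≢ y → Good as →
               AvoidsMesosomes (y ∷ decode x y as) → GoodWord (y ∷ decode x y as)
extend-other x≢y nil av = _ , _ , x≢y ∘ sym , _ , one 0 , refl
extend-other x≢y (one a) av = _ , _ , x≢y ∘ sym , _ , two 0 a , refl
extend-other x≢y (two a b) av with even-or-odd a
... | inj₁ (h , refl) = _ , _ , x≢y ∘ sym , _ , three 0 h b , refl
... | inj₂ (h , refl) = ⊥-elim (¬even-run av x≢y h _ refl)
extend-other x≢y (three a h c) av with even-or-odd a
... | inj₂ (k , refl) = ⊥-elim (¬even-run av x≢y k _ refl)
extend-other x≢y (three _ zero    c) av | inj₁ (zero  , refl) = _ , _ , x≢y ∘ sym , _ , four₁ 0 c , refl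
extend-other x≢y (three _ zero    c) av | inj₁ (suc k , refl) =
  ⊥-elim (¬first≡third av (x≢y ∘ sym) 0 k _ _ refl refl)
extend-other x≢y (three _ (suc h) c) av | inj₁ (k , refl) with c <? k + k
... | yes c<2k = _ , _ , x≢y ∘ sym , _ , four₂ k (suc h) z<s c<2k , refl
... | no  c≮2k = ⊥-elim (¬third≥first av x≢y (k + k) h c _ (≮⇒≥ c≮2k) refl)
extend-other x≢y (four₁ a d) av with even-or-odd a
... | inj₂ (k , refl) = ⊥-elim (¬even-run av x≢y k _ refl)
extend-other x≢y (four₁ _ d) av | inj₁ (suc k , refl) =
  ⊥-elim (¬first≡third av (x≢y ∘ sym) 0 k _ _ refl refl)
extend-other x≢y (four₁ _ zero) av | inj₁ (zero , refl) = _ , _ , x≢y ∘ sym , _ , alt 5 , refl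
extend-other x≢y (four₁ _ (suc d)) av | inj₁ (zero , refl) =
  contradiction (sym (∷-injectiveˡ (prefix-commutes av [ _ ] (_ ∷ _ ∷ []) _ refl))) x≢y
extend-other x≢y (four₂ {a} h l a<2l d<2h) av with even-or-odd a
... | inj₂ (k , refl) = ⊥-elim (¬even-run av x≢y k _ refl)
extend-other x≢y (four₂ (suc h) l a<2l d<2h) av | inj₁ (k , refl) =
  ⊥-elim (¬third≥first av x≢y (k + k) h (l + l) _ (<⇒≤ a<2l) refl)
extend-other x≢y (alt n) av = _ , _ , x≢y ∘ sym , _ , alt (suc n) , refl

other-letter : {x y z : Fin 2} → x ≢ y → z ≢ x → z ≡ y
other-letter {0F} {0F} x≢y z≢x = contradiction refl x≢y
other-letter {1F} {1F} x≢y z≢x = contradiction refl x≢y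
other-letter {0F} {1F} {0F} x≢y z≢x = contradiction refl z≢x
other-letter {0F} {1F} {1F} x≢y z≢x = refl
other-letter {1F} {0F} {0F} x≢y z≢x = refl
other-letter {1F} {0F} {1F} x≢y z≢x = contradiction refl z≢x

avoids⇒good : ∀ w → AvoidsMesosomes w → GoodWord w
avoids⇒good []      av = 0F , 1F , (λ ()) , [] , nil , refl
avoids⇒good (z ∷ w) av
  with x , y , x≢y , as , g , refl ← avoids⇒good w (λ f → av f ∘ there)
  with z Fin.≟ x
... | yes refl = extend-same x≢y g av
... | no  z≢x with refl ← other-letter x≢y z≢x = extend-other x≢y g av

-- Good words avoid mesosomes

-- Relates the codes of a prefix to those of the whole word. A prefix ending inside a run is a
-- `cut`; dropping a run altogether needs `stop`, since the code 0 still stands for one letter.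
data _≼_ : List ℕ → List ℕ → Set where
  stop : ∀ {as} → [] ≼ as
  cut  : ∀ {a b bs} → a ≤ b → [ a ] ≼ (b ∷ bs)
  keep : ∀ {a as bs} → as ≼ bs → (a ∷ as) ≼ (a ∷ bs)

≼-replicate : ∀ n {as} → as ≼ replicate n 0 → ∃ λ m → as ≡ replicate m 0
≼-replicate zero    stop      = 0 , refl
≼-replicate (suc n) stop      = 0 , refl
≼-replicate (suc n) (cut z≤n) = 1 , refl
≼-replicate (suc n) (keep as≼) with m , refl ← ≼-replicate n as≼ = suc m , refl

-- A prefix can shorten only its last run. Outside the alternating case no parity is imposed on a
-- last run, and the one bound on it, `d < h + h`, survives a decrease.
good-≼ : ∀ {as bs} → Good bs → as ≼ bs → Good as
good-≼ (alt n) as≼ with m , refl ← ≼-replicate n as≼ = alt m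
good-≼ _ stop               = nil
good-≼ _ (cut _)            = one _
good-≼ _ (keep stop)        = one _
good-≼ _ (keep (cut _))     = two _ _
good-≼ _ (keep (keep stop)) = two _ _
good-≼ (three a h c)   (keep (keep (cut _)))            = three a h _
good-≼ (three a h c)   (keep (keep (keep stop)))        = three a h c
good-≼ (four₁ a d)     (keep (keep (cut _)))            = three a 0 _
good-≼ (four₁ a d)     (keep (keep (keep stop)))        = three a 0 _
good-≼ (four₁ a d)     (keep (keep (keep (cut _))))     = four₁ a _
good-≼ (four₁ a d)     (keep (keep (keep (keep stop)))) = four₁ a d
good-≼ (four₂ h l p q) (keep (keep (cut _)))            = three _ h _
good-≼ (four₂ h l p q) (keep (keep (keep stop)))        = three _ h _
good-≼ (four₂ h l p q) (keep (keep (keep (cut r))))     = four₂ h l p (≤-<-trans r q)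
good-≼ (four₂ h l p q) (keep (keep (keep (keep stop)))) = four₂ h l p q

decode-prefix : ∀ {x y : A} as p {q} → decode x y as ≡ p ++ q →
                ∃ λ bs → bs ≼ as × p ≡ decode x y bs
decode-prefix as           []      eq = [] , stop , refl
decode-prefix (zero  ∷ as) (z ∷ p) eq
  with refl ← ∷-injectiveˡ eq | bs , bs≼ , refl ← decode-prefix as p (∷-injectiveʳ eq) =
  0 ∷ bs , keep bs≼ , refl
decode-prefix (suc a ∷ as) (z ∷ p) eq
  with refl ← ∷-injectiveˡ eq | decode-prefix (a ∷ as) p (∷-injectiveʳ eq)
... | []     , stop     , refl = [ 0 ] , cut z≤n , refl
... | b ∷ [] , cut b≤a  , refl = [ suc b ] , cut (s≤s b≤a) , refl
... | a ∷ bs , keep bs≼ , refl = suc a ∷ bs , keep bs≼ , refl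

shrink : List ℕ → List ℕ
shrink []           = []
shrink (zero  ∷ as) = as
shrink (suc a ∷ as) = a ∷ as

good-shrink : ∀ {as} → Good as → Good (shrink as)
good-shrink nil = nil
good-shrink (one zero) = nil
good-shrink (one (suc a)) = one a
good-shrink (two zero b) = one b
good-shrink (two (suc a) b) = two a b
good-shrink (three zero h c) = two _ c
good-shrink (three (suc a) h c) = three a h c
good-shrink (four₁ zero d) = three 0 0 d
good-shrink (four₁ (suc a) d) = four₁ a d
good-shrink (four₂ {zero} h l p q) = three _ l _
good-shrink (four₂ {suc a} h l p q) = four₂ h l (<-trans (n<1+n a) p) q
good-shrink (alt zero) = alt 0
good-shrink (alt (suc n)) = alt n

good-tail : ∀ {z w} → GoodWord (z ∷ w) → GoodWord w
good-tail (x , y , x≢y , zero  ∷ as , g , eq) = y , x , x≢y ∘ sym , _ , good-shrink g , ∷-injectiveʳ eq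
good-tail (x , y , x≢y , suc a ∷ as , g , eq) = x , y , x≢y       , _ , good-shrink g , ∷-injectiveʳ eq

good-suffix : ∀ p {q} → GoodWord (p ++ q) → GoodWord q
good-suffix []      g = g
good-suffix (_ ∷ p) g = good-suffix p (good-tail g)

good-prefix : ∀ p {q} → GoodWord (p ++ q) → GoodWord p
good-prefix p (x , y , x≢y , as , g , eq)
  with bs , bs≼as , p≡ ← decode-prefix as p (sym eq) = x , y , x≢y , bs , good-≼ g bs≼as , p≡

good-factor : ∀ {v w} → Factor v w → GoodWord w → GoodWord v
good-factor f g with MkView pre {v} pw suf ← toView f with refl ← Pointwise-≡⇒≡ pw =
  good-prefix v (good-suffix pre g)

-- Letter counts, squares and alternating words

count : Fin 2 → BinaryWord → ℕ
count z w = length (filter (z Fin.≟_) w)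

count-++ : ∀ z p q → count z (p ++ q) ≡ count z p + count z q
count-++ z p q = trans (cong length (filter-++ (z Fin.≟_) p q)) (length-++ (filter (z Fin.≟_) p))

count-same : ∀ z n → count z (replicate n z) ≡ n
count-same z n = trans (cong length (filter-all (z Fin.≟_) (All.replicate⁺ n refl))) (length-replicate n)

count-diff : ∀ {z x} n → z ≢ x → count z (replicate n x) ≡ 0
count-diff n z≢x = cong length (filter-none (_ Fin.≟_) (All.replicate⁺ n z≢x))

-- The letters of `v u` are those of `u v`, so every letter occurs an even number of times. This
-- excludes three runs with an odd middle one, and makes the length of an alternating `u v v u` a
-- multiple of four.
count-uvvu : ∀ z u v → count z ((u ++ v) ++ v ++ u) ≡ count z (u ++ v) + count z (u ++ v)
count-uvvu z u v = begin
  count z ((u ++ v) ++ v ++ u)         ≡⟨ count-++ z (u ++ v) (v ++ u) ⟩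
  count z (u ++ v) + count z (v ++ u)  ≡⟨ cong (count z (u ++ v) +_) (count-++ z v u) ⟩
  count z (u ++ v) + (count z v + count z u)  ≡⟨ cong (count z (u ++ v) +_) (+-comm (count z v) (count z u)) ⟩
  count z (u ++ v) + (count z u + count z v)  ≡⟨ cong (count z (u ++ v) +_) (count-++ z u v) ⟨
  count z (u ++ v) + count z (u ++ v)  ∎

odd≢even : ∀ h k → suc (h + h) ≢ k + k
odd≢even h k eq = even≢odd k h (trans (cong (k +_) (+-identityʳ k))
  (trans (sym eq) (cong (λ n → suc (h + n)) (sym (+-identityʳ h)))))

count-three : ∀ {x y} → x ≢ y → ∀ a b c → count y (decode x y (a ∷ b ∷ c ∷ [])) ≡ suc b
count-three {x} {y} x≢y a b c = begin
  count y (X a ++ Y ++ X c ++ [])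
    ≡⟨ count-++ y (X a) _ ⟩
  count y (X a) + count y (Y ++ X c ++ [])
    ≡⟨ cong₂ _+_ (count-diff (suc a) (x≢y ∘ sym)) (count-++ y Y _) ⟩
  count y Y + count y (X c ++ [])
    ≡⟨ cong₂ _+_ (count-same y (suc b)) (trans (count-++ y (X c) []) (+-identityʳ _)) ⟩
  suc b + count y (X c)
    ≡⟨ cong (suc b +_) (count-diff (suc c) (x≢y ∘ sym)) ⟩
  suc b + 0
    ≡⟨ +-identityʳ (suc b) ⟩
  suc b ∎
  where
  X : ℕ → BinaryWord
  X n = replicate (suc n) x
  Y : BinaryWord
  Y = replicate (suc b) y

++-injective : ∀ (p p′ : List A) {q q′} → length p ≡ length p′ → p ++ q ≡ p′ ++ q′ → p ≡ p′ × q ≡ q′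
++-injective []      []        l e = refl , e
++-injective (x ∷ p) (x′ ∷ p′) l e
  with refl ← ∷-injectiveˡ e | refl , e′ ← ++-injective p p′ (suc-injective l) (∷-injectiveʳ e) = refl , e′

double-injective : ∀ m n → m + m ≡ n + n → m ≡ n
double-injective zero    zero    e = refl
double-injective (suc m) (suc n) e =
  cong suc (double-injective m n (suc-injective (trans (sym (+-suc m m)) (trans (suc-injective e) (+-suc n n)))))

length-uvvu : ∀ (u v : List A) → length ((u ++ v) ++ v ++ u) ≡ length (u ++ v) + length (u ++ v)
length-uvvu u v = trans (length-++ (u ++ v)) (cong (length (u ++ v) +_) (length-++-comm v u))

-- Since `u v` and `v u` have equal length, cutting `s s` in the middle identifies both with `s`.
square-commutes : ∀ (u v s : List A) → (u ++ v) ++ v ++ u ≡ s ++ s → u ++ v ≡ v ++ u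
square-commutes u v s eq
  with e₁ , e₂ ← ++-injective (u ++ v) s
         (double-injective _ _ (trans (sym (length-uvvu u v)) (trans (cong length eq) (length-++ s)))) eq =
  trans e₁ (sym e₂)

length-alternating : ∀ {x y : A} n → length (decode x y (replicate n 0)) ≡ n
length-alternating zero = refl
length-alternating (suc n) = cong suc (length-alternating n)

count-∷-same : ∀ x w → count x (x ∷ w) ≡ suc (count x w)
count-∷-same x w with x Fin.≟ x
... | yes _ = refl
... | no ne = contradiction refl ne

count-∷-diff : ∀ {x y} → x ≢ y → ∀ w → count x (y ∷ w) ≡ count x w
count-∷-diff {x} {y} x≢y w with x Fin.≟ y
... | yes e = contradiction e x≢y
... | no ne = refl

count-alternating : ∀ {x y} → x ≢ y → ∀ l → count x (decode x y (replicate (l + l) 0)) ≡ l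
count-alternating x≢y zero = refl
count-alternating {x} {y} x≢y (suc l) rewrite +-suc l l =
  trans (count-∷-same x _) (cong suc (trans (count-∷-diff x≢y _) (count-alternating x≢y l)))

alternating-square : ∀ {x y : A} h l → decode x y (replicate ((h + h) + l) 0) ≡
                                 decode x y (replicate (h + h) 0) ++ decode x y (replicate l 0)
alternating-square zero l = refl
alternating-square {x = x} {y} (suc h) l rewrite +-suc h h = cong (λ w → x ∷ y ∷ w) (alternating-square h l)

-- Uniqueness of run codes and changes of letter

decode-injective : ∀ {x y : A} → x ≢ y → ∀ as bs → decode x y as ≡ decode x y bs → as ≡ bs
decode-injective x≢y [] [] e = refl
decode-injective x≢y (zero ∷ as) (zero ∷ bs) e = cong (0 ∷_) (decode-injective (x≢y ∘ sym) as bs (∷-injectiveʳ e))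
decode-injective x≢y (zero ∷ _ ∷ as) (suc b ∷ bs) e = contradiction (sym (∷-injectiveˡ (∷-injectiveʳ e))) x≢y
decode-injective x≢y (suc a ∷ as) (zero ∷ _ ∷ bs) e = contradiction (∷-injectiveˡ (∷-injectiveʳ e)) x≢y
decode-injective x≢y (suc a ∷ as) (suc b ∷ bs) e with refl ← decode-injective x≢y (a ∷ as) (b ∷ bs) (∷-injectiveʳ e) = refl

encode : ∀ {x y} → x ≢ y → ∀ w → ∃₂ λ a as → x ∷ w ≡ decode x y (a ∷ as)
encode x≢y [] = 0 , [] , refl
encode {x} {y} x≢y (z ∷ w) with z Fin.≟ x
... | yes refl with a , as , eq ← encode x≢y w = suc a , as , cong (x ∷_) eq
... | no z≢x with refl ← other-letter x≢y z≢x | a , as , eq ← encode (x≢y ∘ sym) w = 0 , a ∷ as , cong (x ∷_) eq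

switch : Fin 2 → Fin 2 → ℕ
switch x y with x Fin.≟ y
... | yes _ = 0
... | no  _ = 1

switches : BinaryWord → ℕ
switches []          = 0
switches (x ∷ [])    = 0
switches (x ∷ y ∷ w) = switch x y + switches (y ∷ w)

switches-++ : ∀ p q → switches p + switches q ≤ switches (p ++ q)
switches-++ []          q       = ≤-refl
switches-++ (x ∷ [])    []      = ≤-refl
switches-++ (x ∷ [])    (y ∷ q) = m≤n+m _ (switch x y)
switches-++ (x ∷ y ∷ p) q       = ≤-trans
  (≤-reflexive (+-assoc (switch x y) _ _))
  (+-monoʳ-≤ (switch x y) (switches-++ (y ∷ p) q))

switches-decode : ∀ {x y} → x ≢ y → ∀ a as → switches (decode x y (a ∷ as)) ≡ length as
switches-decode x≢y zero [] = refl
switches-decode {x} {y} x≢y zero (b ∷ as) with x Fin.≟ y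
... | yes e = contradiction e x≢y
... | no  _ = cong suc (switches-decode (x≢y ∘ sym) b as)
switches-decode {x} x≢y (suc a) as with x Fin.≟ x
... | yes _ = switches-decode x≢y a as
... | no ne = contradiction refl ne

last-run : ∀ (p : List A) n {x} → p ++ replicate (suc n) x ++ [] ≡ (p ++ replicate n x) ∷ʳ x
last-run p n {x} = trans (cong (p ++_) (sym (replicate-∷ n []))) (sym (++-assoc p (replicate n x) [ x ]))

-- The word `z ∷ u` begins with `x` and, as a suffix of the other word, ends with `y`. A single run
-- would begin and end alike, so there is a second one.
switched : ∀ {x y} → x ≢ y → ∀ {z u r s p} →
           z ∷ u ++ r ≡ x ∷ s → (∃ λ q → p ++ z ∷ u ≡ q ∷ʳ y) →
           ∃₂ λ i j → ∃ λ is → z ∷ u ≡ decode x y (i ∷ j ∷ is)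
switched x≢y {u = u} {p = p} start (_ , end)
  with refl ← ∷-injectiveˡ start | encode x≢y u
... | i , j ∷ is , eq = i , j , is , eq
... | i , []     , eq = contradiction
  (∷ʳ-injectiveʳ _ _ (trans (sym (last-run p i)) (trans (cong (p ++_) (sym eq)) end))) x≢y

switches-encoded : ∀ {x y} → x ≢ y → ∀ {w} a as → w ≡ decode x y (a ∷ as) → length as ≤ switches w
switches-encoded x≢y a as refl = ≤-reflexive (sym (switches-decode x≢y a as))

-- A change inside `u` or `v` is counted twice, while two runs allow one change and four runs three.
-- Hence one change in `u` is too many for two runs, and for four runs `u` and `v` together have at
-- most one.
switches-uvvu : ∀ u v {m n} → m ≤ switches u → n ≤ switches v →
                (m + n) + (n + m) ≤ switches ((u ++ v) ++ v ++ u)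
switches-uvvu u v m≤ n≤ = ≤-trans
  (+-mono-≤ (≤-trans (+-mono-≤ m≤ n≤) (switches-++ u v)) (≤-trans (+-mono-≤ n≤ m≤) (switches-++ v u)))
  (switches-++ (u ++ v) (v ++ u))

flatten-uvvu : ∀ (p q r : List A) →
               ((p ++ q ++ []) ++ r ++ []) ++ (r ++ []) ++ p ++ q ++ [] ≡ p ++ q ++ r ++ r ++ p ++ q ++ []
flatten-uvvu p q r = begin
  ((p ++ q ++ []) ++ r ++ []) ++ (r ++ []) ++ p ++ q ++ []
    ≡⟨ cong₂ (λ q′ r′ → ((p ++ q′) ++ r′) ++ r′ ++ p ++ q ++ []) (++-identityʳ q) (++-identityʳ r) ⟩
  ((p ++ q) ++ r) ++ r ++ p ++ q ++ []
    ≡⟨ ++-assoc (p ++ q) r _ ⟩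
  (p ++ q) ++ r ++ r ++ p ++ q ++ []
    ≡⟨ ++-assoc p q _ ⟩
  p ++ q ++ r ++ r ++ p ++ q ++ [] ∎

-- Factorisations `u v v u` of members

module _ {x y : Fin 2} (x≢y : x ≢ y) where

  two-commutes : ∀ a b u v → decode x y (a ∷ b ∷ []) ≡ (u ++ v) ++ v ++ u → u ++ v ≡ v ++ u
  two-commutes a b []      v eq = sym (++-identityʳ v)
  two-commutes a b (z ∷ u) v eq
    with i , j , is , u≡ ← switched x≢y {p = ((z ∷ u) ++ v) ++ v}
           (trans (sym (++-assoc (z ∷ u) v _)) (sym eq))
           (replicate (suc a) x ++ replicate b y ,
            trans (++-assoc ((z ∷ u) ++ v) v (z ∷ u)) (trans (sym eq) (last-run (replicate (suc a) x) b))) =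
    contradiction
      (≤-trans (switches-uvvu (z ∷ u) v {1} (≤-trans (s≤s z≤n) (switches-encoded x≢y i (j ∷ is) u≡)) z≤n)
               (≤-reflexive (trans (cong switches (sym eq)) (switches-decode x≢y a (b ∷ [])))))
      λ { (s≤s ()) }

  last-of-four : ∀ a b c d → ∃ λ q → decode x y (a ∷ b ∷ c ∷ d ∷ []) ≡ q ∷ʳ y
  last-of-four a b c d = (X ++ Y ++ Z) ++ replicate d y , (begin
    X ++ Y ++ Z ++ T    ≡⟨ cong (X ++_) (++-assoc Y Z T) ⟨
    X ++ (Y ++ Z) ++ T  ≡⟨ ++-assoc X (Y ++ Z) T ⟨
    (X ++ Y ++ Z) ++ T  ≡⟨ last-run (X ++ Y ++ Z) d ⟩
    _                   ∎)
    where
    X Y Z T : BinaryWord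
    X = replicate (suc a) x
    Y = replicate (suc b) y
    Z = replicate (suc c) x
    T = decode y x (d ∷ [])

  -- Both copies of `v`, a power of `x`, merge with the `x` run of the second `u`, so that `u v v u`
  -- has the codes `i`, `j`, `2 (p + 1) + i`, `j`. Codes are unique and can be compared entry by
  -- entry.
  third-run : ∀ {a b c d} i j p →
              let u = decode x y (i ∷ j ∷ []) ; v = decode x y (p ∷ []) in
              decode x y (a ∷ b ∷ c ∷ d ∷ []) ≡ (u ++ v) ++ v ++ u → c ≡ suc p + suc p + a × b ≡ d
  third-run i j p eq = from-codes (decode-injective x≢y _ (i ∷ j ∷ suc p + suc p + i ∷ j ∷ []) (begin
    _                                  ≡⟨ trans eq (flatten-uvvu X Y P) ⟩
    X ++ Y ++ P ++ P ++ X ++ Y ++ []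
      ≡⟨ cong (λ w → X ++ Y ++ P ++ w) (replicate-+ (suc p) (suc i) _) ⟨
    X ++ Y ++ P ++ replicate (suc p + suc i) x ++ Y ++ []
      ≡⟨ cong (λ w → X ++ Y ++ w) (replicate-+ (suc p) (suc p + suc i) _) ⟨
    X ++ Y ++ replicate (suc p + (suc p + suc i)) x ++ Y ++ []
      ≡⟨ cong (λ k → X ++ Y ++ replicate k x ++ Y ++ [])
           (trans (sym (+-assoc (suc p) (suc p) (suc i))) (+-suc (suc p + suc p) i)) ⟩
    decode x y (i ∷ j ∷ suc p + suc p + i ∷ j ∷ []) ∎))
    where
    X Y P : BinaryWord
    X = replicate (suc i) x
    Y = replicate (suc j) y
    P = replicate (suc p) x
    from-codes : ∀ {a b c d : ℕ} → (List ℕ ∋ a ∷ b ∷ c ∷ d ∷ []) ≡ i ∷ j ∷ suc p + suc p + i ∷ j ∷ [] →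
                 c ≡ suc p + suc p + a × b ≡ d
    from-codes refl = refl , refl

  -- Now `v` is a power of `y`, and both copies extend the first `y` run, giving the codes `i`,
  -- `j + 2 (p + 1)`, `i`, `j`.
  second-run : ∀ {a b c d} i j p →
               let u = decode x y (i ∷ j ∷ []) ; v = decode y x (p ∷ []) in
               decode x y (a ∷ b ∷ c ∷ d ∷ []) ≡ (u ++ v) ++ v ++ u → b ≡ d + (suc p + suc p) × c ≡ a
  second-run i j p eq = from-codes (decode-injective x≢y _ (i ∷ j + (suc p + suc p) ∷ i ∷ j ∷ []) (begin
    _                                  ≡⟨ trans eq (flatten-uvvu X Y P) ⟩
    X ++ Y ++ P ++ P ++ X ++ Y ++ []
      ≡⟨ cong (λ w → X ++ Y ++ w) (replicate-+ (suc p) (suc p) _) ⟨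
    X ++ Y ++ replicate (suc p + suc p) y ++ X ++ Y ++ []
      ≡⟨ cong (X ++_) (replicate-+ (suc j) (suc p + suc p) _) ⟨
    decode x y (i ∷ j + (suc p + suc p) ∷ i ∷ j ∷ []) ∎))
    where
    X Y P : BinaryWord
    X = replicate (suc i) x
    Y = replicate (suc j) y
    P = replicate (suc p) y
    from-codes : ∀ {a b c d : ℕ} → (List ℕ ∋ a ∷ b ∷ c ∷ d ∷ []) ≡ i ∷ j + (suc p + suc p) ∷ i ∷ j ∷ [] →
                 b ≡ d + (suc p + suc p) × c ≡ a
    from-codes refl = refl , refl

  -- Here u = x^i y^j, and v is a power of x, lying inside the third run of
  -- u v v u, or a power of y, lying inside the second.
  four-runs : ∀ a b c d u v → decode x y (a ∷ b ∷ c ∷ d ∷ []) ≡ (u ++ v) ++ v ++ u →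
              u ++ v ≢ v ++ u → ∃ λ p → (c ≡ suc p + suc p + a × b ≡ d) ⊎ (b ≡ d + (suc p + suc p) × c ≡ a)
  four-runs a b c d []      v  eq ne = contradiction (sym (++-identityʳ v)) ne
  four-runs a b c d (z ∷ u) [] eq ne = contradiction (++-identityʳ (z ∷ u)) ne
  four-runs a b c d (z ∷ u) (z′ ∷ v) eq ne
    with switched x≢y {p = ((z ∷ u) ++ z′ ∷ v) ++ z′ ∷ v}
           (trans (sym (++-assoc (z ∷ u) (z′ ∷ v) _)) (sym eq))
           (map₂ (λ last → trans (++-assoc ((z ∷ u) ++ z′ ∷ v) (z′ ∷ v) (z ∷ u)) (trans (sym eq) last))
                 (last-of-four a b c d))
  ... | i , j , is , u≡ = cases is u≡
    where
    bound : ∀ {m n} → m ≤ switches (z ∷ u) → n ≤ switches (z′ ∷ v) → (m + n) + (n + m) ≤ 3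
    bound m≤ n≤ = ≤-trans (switches-uvvu (z ∷ u) (z′ ∷ v) m≤ n≤)
      (≤-reflexive (trans (cong switches (sym eq)) (switches-decode x≢y a (b ∷ c ∷ d ∷ []))))
    rewritten : ∀ {u′ v′} → z ∷ u ≡ u′ → z′ ∷ v ≡ v′ →
                decode x y (a ∷ b ∷ c ∷ d ∷ []) ≡ (u′ ++ v′) ++ v′ ++ u′
    rewritten u≡ v≡ = trans eq (cong₂ (λ u′ v′ → (u′ ++ v′) ++ v′ ++ u′) u≡ v≡)
    too-many : ¬ 4 ≤ 3
    too-many = 1+n≰n
    cases : ∀ is → z ∷ u ≡ decode x y (i ∷ j ∷ is) →
            ∃ λ p → (c ≡ suc p + suc p + a × b ≡ d) ⊎ (b ≡ d + (suc p + suc p) × c ≡ a)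
    cases (k ∷ is) u≡ = contradiction
      (bound {2} (≤-trans (s≤s (s≤s z≤n)) (switches-encoded x≢y i (j ∷ k ∷ is) u≡)) z≤n) too-many
    cases [] u≡ with z′ Fin.≟ x
    cases [] u≡ | yes refl with encode x≢y v
    ... | p , [] , v≡ = p , inj₁ (third-run i j p (rewritten u≡ v≡))
    ... | p , q ∷ ps , v≡ = contradiction
      (bound {1} {1} (switches-encoded x≢y i (j ∷ []) u≡)
                     (≤-trans (s≤s z≤n) (switches-encoded x≢y p (q ∷ ps) v≡))) too-many
    cases [] u≡ | no z′≢x with refl ← other-letter x≢y z′≢x with encode (x≢y ∘ sym) v
    ... | p , [] , v≡ = p , inj₂ (second-run i j p (rewritten u≡ v≡))
    ... | p , q ∷ ps , v≡ = contradiction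
      (bound {1} {1} (switches-encoded x≢y i (j ∷ []) u≡)
                     (≤-trans (s≤s z≤n) (switches-encoded (x≢y ∘ sym) p (q ∷ ps) v≡))) too-many

  good-commutes : ∀ {as} → Good as → ∀ u v → decode x y as ≡ (u ++ v) ++ v ++ u → u ++ v ≡ v ++ u
  good-commutes nil u v eq = trans (++-conicalˡ (u ++ v) _ (sym eq)) (sym (++-conicalʳ (u ++ v) _ (sym eq)))
  good-commutes (one a) u v eq = square-commutes u v (replicate l x) (begin
    (u ++ v) ++ v ++ u                    ≡⟨ eq ⟨
    replicate (suc a) x ++ []             ≡⟨ cong (λ n → replicate n x ++ []) 1+a≡2l ⟩
    replicate (l + l) x ++ []             ≡⟨ replicate-+ l l [] ⟩
    replicate l x ++ replicate l x ++ []  ≡⟨ cong (replicate l x ++_) (++-identityʳ _) ⟩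
    replicate l x ++ replicate l x        ∎)
    where
    l : ℕ
    l = length (u ++ v)
    1+a≡2l : suc a ≡ l + l
    1+a≡2l = begin
      suc a                               ≡⟨ length-replicate (suc a) ⟨
      length (replicate (suc a) x)        ≡⟨ cong length (++-identityʳ (replicate (suc a) x)) ⟨
      length (replicate (suc a) x ++ [])  ≡⟨ cong length eq ⟩
      length ((u ++ v) ++ v ++ u)         ≡⟨ length-uvvu u v ⟩
      l + l                               ∎
  good-commutes (two a b) u v eq = two-commutes a b u v eq
  good-commutes (three a h c) u v eq = contradiction
    (trans (sym (count-three x≢y a (h + h) c)) (trans (cong (count y) eq) (count-uvvu y u v)))
    (odd≢even h (count y (u ++ v)))
  good-commutes (four₁ a d) u v eq = decidable-stable (≡-dec Fin._≟_ (u ++ v) (v ++ u)) λ ne →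
    -- Both alternatives ask for a positive inner code, and here the inner codes are 0.
    case four-runs a 0 0 d u v eq ne of λ
      { (p , inj₁ (() , _))
      ; (p , inj₂ (0≡ , _)) → contradiction (trans 0≡ (+-suc d _)) λ () }
  good-commutes (four₂ {a} {d} h l a<2l d<2h) u v eq = decidable-stable (≡-dec Fin._≟_ (u ++ v) (v ++ u)) λ ne →
    -- The equations `b ≡ d` and `c ≡ a` contradict the two strict bounds.
    case four-runs a (h + h) (l + l) d u v eq ne of λ
      { (p , inj₁ (_ , 2h≡d)) → <-irrefl (sym 2h≡d) d<2h
      ; (p , inj₂ (_ , 2l≡a)) → <-irrefl (sym 2l≡a) a<2l }
  good-commutes (alt n) u v eq = square-commutes u v (decode x y (replicate (k + k) 0)) (begin
      (u ++ v) ++ v ++ u ≡⟨ eq ⟨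
      decode x y (replicate n 0) ≡⟨ cong (λ n → decode x y (replicate n 0)) n≡ ⟩
      decode x y (replicate ((k + k) + (k + k)) 0) ≡⟨ alternating-square k (k + k) ⟩
      _ ∎)
    where
    l k : ℕ
    l = length (u ++ v)
    k = count x (u ++ v)
    n≡2l : n ≡ l + l
    n≡2l = trans (sym (length-alternating n)) (trans (cong length eq) (length-uvvu u v))
    -- Half of the `2 l` alternating letters are `x`, and `x` occurs `2 k` times. So the word is the
    -- square of an alternating block of even length.
    l≡2k : l ≡ k + k
    l≡2k = begin
      l ≡⟨ count-alternating x≢y l ⟨
      count x (decode x y (replicate (l + l) 0)) ≡⟨ cong (λ n → count x (decode x y (replicate n 0))) n≡2l ⟨
      count x (decode x y (replicate n 0)) ≡⟨ cong (count x) eq ⟩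
      count x ((u ++ v) ++ v ++ u) ≡⟨ count-uvvu x u v ⟩
      k + k ∎
    n≡ : n ≡ (k + k) + (k + k)
    n≡ = trans n≡2l (cong₂ _+_ l≡2k l≡2k)

good⇒avoids : ∀ {w} → GoodWord w → AvoidsMesosomes w
good⇒avoids g _ f (_ , _ , _ , refl , (u , v , refl , refl) , uv≢vu)
  with x , y , x≢y , as , gas , eq ← good-factor f g =
  uv≢vu (good-commutes x≢y gas u v (sym eq))

-- Graded enumerations

-- The Cauchy product of two sequences. The recursion shifts `f` just as `_⊛_` shifts `xs`, so that
-- lengths match term by term.
convolution : (ℕ → ℕ) → (ℕ → ℕ) → ℕ → ℕ
convolution f g zero    = f 0 * g 0
convolution f g (suc k) = f 0 * g (suc k) + convolution (f ∘ suc) g k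

convolution-cong : ∀ {f f′ g g′} → f ≗ f′ → g ≗ g′ → convolution f g ≗ convolution f′ g′
convolution-cong f≗ g≗ zero    = cong₂ _*_ (f≗ 0) (g≗ 0)
convolution-cong f≗ g≗ (suc k) =
  cong₂ _+_ (cong₂ _*_ (f≗ 0) (g≗ (suc k))) (convolution-cong (f≗ ∘ suc) g≗ k)

_⊛_ : (ℕ → List A) → (ℕ → List B) → ℕ → List (A × B)
(xs ⊛ ys) zero    = cartesianProduct (xs 0) (ys 0)
(xs ⊛ ys) (suc k) = cartesianProduct (xs 0) (ys (suc k)) ++ ((xs ∘ suc) ⊛ ys) k

length-cartesianProduct : ∀ (xs : List A) (ys : List B) →
                          length (cartesianProduct xs ys) ≡ length xs * length ys
length-cartesianProduct []       ys = refl
length-cartesianProduct (x ∷ xs) ys = trans (length-++ (map (x ,_) ys))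
  (cong₂ _+_ (length-map (x ,_) ys) (length-cartesianProduct xs ys))

length-⊛ : ∀ (xs : ℕ → List A) (ys : ℕ → List B) k →
           length ((xs ⊛ ys) k) ≡ convolution (length ∘ xs) (length ∘ ys) k
length-⊛ xs ys zero    = length-cartesianProduct (xs 0) (ys 0)
length-⊛ xs ys (suc k) = trans (length-++ (cartesianProduct (xs 0) (ys (suc k))))
  (cong₂ _+_ (length-cartesianProduct (xs 0) (ys (suc k))) (length-⊛ (xs ∘ suc) ys k))

∈-⊛⁺ : ∀ (xs : ℕ → List A) (ys : ℕ → List B) {x y} i j →
       x ∈ xs i → y ∈ ys j → (x , y) ∈ (xs ⊛ ys) (i + j)
∈-⊛⁺ xs ys zero    zero    x∈ y∈ = ∈-cartesianProduct⁺ x∈ y∈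
∈-⊛⁺ xs ys zero    (suc j) x∈ y∈ = ∈-++⁺ˡ (∈-cartesianProduct⁺ x∈ y∈)
∈-⊛⁺ xs ys (suc i) j       x∈ y∈ = ∈-++⁺ʳ (cartesianProduct (xs 0) _) (∈-⊛⁺ (xs ∘ suc) ys i j x∈ y∈)

∈-⊛⁻ : ∀ (xs : ℕ → List A) (ys : ℕ → List B) k {xy} → xy ∈ (xs ⊛ ys) k →
       ∃₂ λ i j → i + j ≡ k × proj₁ xy ∈ xs i × proj₂ xy ∈ ys j
∈-⊛⁻ xs ys zero    xy∈ = 0 , 0 , refl , ∈-cartesianProduct⁻ (xs 0) (ys 0) xy∈
∈-⊛⁻ xs ys (suc k) xy∈ with ∈-++⁻ (cartesianProduct (xs 0) (ys (suc k))) xy∈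
... | inj₁ ∈₀ = 0 , suc k , refl , ∈-cartesianProduct⁻ (xs 0) (ys (suc k)) ∈₀
... | inj₂ ∈₊ with i , j , refl , x∈ , y∈ ← ∈-⊛⁻ (xs ∘ suc) ys k ∈₊ = suc i , j , refl , x∈ , y∈

⊛-unique : ∀ (xs : ℕ → List A) (ys : ℕ → List B) →
           (∀ i → Unique (xs i)) → (∀ j → Unique (ys j)) →
           (∀ i j {x} → x ∈ xs i → x ∈ xs j → i ≡ j) →
           ∀ k → Unique ((xs ⊛ ys) k)
⊛-unique xs ys uxs uys graded zero    = Unique.cartesianProduct⁺ (uxs 0) (uys 0)
⊛-unique xs ys uxs uys graded (suc k) = Unique.++⁺
  (Unique.cartesianProduct⁺ (uxs 0) (uys (suc k)))
  (⊛-unique (xs ∘ suc) ys (uxs ∘ suc) uys (λ i j x∈ x∈′ → suc-injective (graded (suc i) (suc j) x∈ x∈′)) k)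
  λ (xy∈₀ , xy∈₊) → case ∈-⊛⁻ (xs ∘ suc) ys k xy∈₊ of λ (i , j , _ , x∈ , _) →
    contradiction (graded 0 (suc i) (proj₁ (∈-cartesianProduct⁻ (xs 0) (ys (suc k)) xy∈₀)) x∈) λ ()

-- A finite graded class. Degrees add under `product`, so counting functions become convolutions.
record Enumeration (P : A → Set) (deg : A → ℕ) : Set where
  field
    list     : ℕ → List A
    unique   : ∀ k → Unique (list k)
    sound    : ∀ k {x} → x ∈ list k → P x × deg x ≡ k
    complete : ∀ {x} → P x → x ∈ list (deg x)

open Enumeration

product : {P : A → Set} {Q : B → Set} {deg : A → ℕ} {deg′ : B → ℕ} →
          Enumeration P deg → Enumeration Q deg′ →
          Enumeration (λ (x , y) → P x × Q y) (λ (x , y) → deg x + deg′ y)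
product e f .list = list e ⊛ list f
product e f .unique = ⊛-unique (list e) (list f) (unique e) (unique f)
  λ i j x∈ x∈′ → trans (sym (proj₂ (sound e i x∈))) (proj₂ (sound e j x∈′))
product e f .sound k xy∈ with i , j , refl , x∈ , y∈ ← ∈-⊛⁻ (list e) (list f) k xy∈
  with p , refl ← sound e i x∈ | q , refl ← sound f j y∈ = (p , q) , refl
product e f .complete (p , q) = ∈-⊛⁺ (list e) (list f) _ _ (complete e p) (complete f q)

-- Even numbers and corners

naturals : Enumeration {ℕ} (λ _ → ⊤) (λ n → n)
naturals .list n = [ n ]
naturals .unique n = [] ∷ []
naturals .sound n (here refl) = tt , refl
naturals .complete _ = here refl

Even : ℕ → Set
Even n = ∃ λ h → n ≡ h + h

evensOf : ℕ → List ℕ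
evensOf zero          = [ 0 ]
evensOf (suc zero)    = []
evensOf (suc (suc k)) = map (2 +_) (evensOf k)

evensOf-unique : ∀ k → Unique (evensOf k)
evensOf-unique zero          = [] ∷ []
evensOf-unique (suc zero)    = []
evensOf-unique (suc (suc k)) = Unique.map⁺ (+-cancelˡ-≡ 2 _ _) (evensOf-unique k)

∈-evensOf⁻ : ∀ k {n} → n ∈ evensOf k → Even n × n ≡ k
∈-evensOf⁻ zero (here refl) = (0 , refl) , refl
∈-evensOf⁻ (suc (suc k)) n∈ with n , n∈′ , refl ← ∈-map⁻ (2 +_) n∈
  with (h , refl) , refl ← ∈-evensOf⁻ k n∈′ = (suc h , cong suc (sym (+-suc h h))) , refl

∈-evensOf⁺ : ∀ h → h + h ∈ evensOf (h + h)
∈-evensOf⁺ zero    = here refl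
∈-evensOf⁺ (suc h) rewrite +-suc h h = ∈-map⁺ (2 +_) (∈-evensOf⁺ h)

evens : Enumeration Even (λ n → n)
evens .list     = evensOf
evens .unique   = evensOf-unique
evens .sound    = ∈-evensOf⁻
evens .complete (h , refl) = ∈-evensOf⁺ h

-- The constructor four₂ amounts to (a , c) and (d , b) being corners. A corner
-- with a ≥ 2 is the shift of another one, and for every sum ≥ 2 there is exactly
-- one corner with a ≤ 1.
Corner : ℕ × ℕ → Set
Corner (a , b) = a < b × Even b

-- The index is two below the sum, since no corner has sum 0 or 1. As the second coordinate is even,
-- the parity of the sum decides between 0 and 1 for the first.
corner : ℕ → ℕ × ℕ
corner s with even-or-odd s
... | inj₁ (h , _) = 0 , suc h + suc h
... | inj₂ (h , _) = 1 , suc h + suc h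

corner-even : ∀ h → corner (h + h) ≡ (0 , suc h + suc h)
corner-even h with even-or-odd (h + h)
... | inj₁ (k , eq) with refl ← double-injective h k eq = refl
... | inj₂ (k , eq) = contradiction (sym eq) (odd≢even k h)

corner-odd : ∀ h → corner (suc (h + h)) ≡ (1 , suc h + suc h)
corner-odd h with even-or-odd (suc (h + h))
... | inj₁ (k , eq) = contradiction eq (odd≢even h k)
... | inj₂ (k , eq) with refl ← double-injective h k (suc-injective eq) = refl

corner-sound : ∀ s → Corner (corner s) × proj₁ (corner s) + proj₂ (corner s) ≡ 2 + s
corner-sound s with even-or-odd s
... | inj₁ (h , refl) = (s≤s z≤n , suc h , refl) , cong suc (+-suc h h)
... | inj₂ (h , refl) = (s≤s (≤-trans (s≤s z≤n) (m≤n+m (suc h) h)) , suc h , refl) , cong (2 +_) (+-suc h h)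

corner≤1 : ∀ s → proj₁ (corner s) ≤ 1
corner≤1 s with even-or-odd s
... | inj₁ _ = z≤n
... | inj₂ _ = s≤s z≤n

shift : ℕ × ℕ → ℕ × ℕ
shift (a , b) = 2 + a , 2 + b

cornersOf : ℕ → List (ℕ × ℕ)
cornersOf 0 = []
cornersOf 1 = []
cornersOf 2 = [ corner 0 ]
cornersOf 3 = [ corner 1 ]
cornersOf (suc (suc (suc (suc s)))) = corner (2 + s) ∷ map shift (cornersOf s)

cornersOf-unique : ∀ s → Unique (cornersOf s)
cornersOf-unique 0 = []
cornersOf-unique 1 = []
cornersOf-unique 2 = [] ∷ []
cornersOf-unique 3 = [] ∷ []
cornersOf-unique (suc (suc (suc (suc s)))) =
  All.map⁺ (All.universal (λ x eq → 1+n≰n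
    (≤-trans (s≤s (s≤s z≤n)) (subst (_≤ 1) (cong proj₁ eq) (corner≤1 (2 + s))))) (cornersOf s)) ∷
  Unique.map⁺ (λ { refl → refl }) (cornersOf-unique s)

∈-cornersOf⁻ : ∀ s {x} → x ∈ cornersOf s → Corner x × proj₁ x + proj₂ x ≡ s
∈-cornersOf⁻ 2 (here refl) = corner-sound 0
∈-cornersOf⁻ 3 (here refl) = corner-sound 1
∈-cornersOf⁻ (suc (suc (suc (suc s)))) (here refl) = corner-sound (2 + s)
∈-cornersOf⁻ (suc (suc (suc (suc s)))) (there x∈)
  with (a , b) , x∈′ , refl ← ∈-map⁻ shift x∈
  with (a<b , h , refl) , refl ← ∈-cornersOf⁻ s x∈′ =
  (s≤s (s≤s a<b) , suc h , cong suc (sym (+-suc h h))) ,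
  cong (2 +_) (trans (+-suc a _) (cong suc (+-suc a _)))

corner∈ : ∀ s → corner s ∈ cornersOf (2 + s)
corner∈ zero          = here refl
corner∈ (suc zero)    = here refl
corner∈ (suc (suc s)) = here refl

-- Induction on `a` in steps of two, undoing `shift`; the cases `a ≤ 1` are values of `corner`.
∈-cornersOf⁺ : ∀ a h → a < h + h → (a , h + h) ∈ cornersOf (a + (h + h))
∈-cornersOf⁺ zero (suc h) a<2h =
  subst₂ (λ x s → x ∈ cornersOf s) (corner-even h) (cong suc (sym (+-suc h h))) (corner∈ (h + h))
∈-cornersOf⁺ (suc zero) (suc h) a<2h =
  subst₂ (λ x s → x ∈ cornersOf s) (corner-odd h) (cong (2 +_) (sym (+-suc h h))) (corner∈ (suc (h + h)))
∈-cornersOf⁺ (suc (suc a)) (suc h) a<2h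
  rewrite +-suc h h | +-suc a (suc (h + h)) | +-suc a (h + h) with s≤s (s≤s a<2h′) ← a<2h =
  there (∈-map⁺ shift (∈-cornersOf⁺ a h a<2h′))

corners : Enumeration Corner (uncurry _+_)
corners .list   = cornersOf
corners .unique = cornersOf-unique
corners .sound  = ∈-cornersOf⁻
corners .complete {a , _} (a<2h , h , refl) = ∈-cornersOf⁺ a h a<2h

-- The six kinds of codes

pairs : Enumeration (λ _ → ⊤ × ⊤) (uncurry _+_)
pairs = product naturals naturals

triples : Enumeration (λ (_ , b , _) → ⊤ × Even b × ⊤) (λ (a , b , c) → a + (b + c))
triples = product naturals (product evens naturals)

-- The bounds of `four₂` pair the first run with the third and the last with the second, so a code
-- splits into two independent corners.
quadruples : Enumeration (λ (p , q) → Corner p × Corner q) (λ ((a , c) , (d , b)) → (a + c) + (d + b))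
quadruples = product corners corners

pairCode₂ pairCode₄ : ℕ × ℕ → List ℕ
pairCode₂ (a , b) = a ∷ b ∷ []
pairCode₄ (a , d) = a ∷ 0 ∷ 0 ∷ d ∷ []

tripleCode : ℕ × ℕ × ℕ → List ℕ
tripleCode (a , b , c) = a ∷ b ∷ c ∷ []

quadrupleCode : (ℕ × ℕ) × (ℕ × ℕ) → List ℕ
quadrupleCode ((a , c) , (d , b)) = a ∷ b ∷ c ∷ d ∷ []

-- For words of length `5 + n`: with `r` runs the codes sum to `5 + n - r`. From length five on an
-- alternating word has more than four runs.
codesOf : ℕ → Fin 6 → List (List ℕ)
codesOf n 0F = [ [ 4 + n ] ]
codesOf n 1F = map pairCode₂ (list pairs (3 + n))
codesOf n 2F = map tripleCode (list triples (2 + n))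
codesOf n 3F = map pairCode₄ (list pairs (1 + n))
codesOf n 4F = map quadrupleCode (list quadruples (1 + n))
codesOf n 5F = [ replicate (5 + n) 0 ]

-- Recovers the index in `codesOf`, which makes the six lists disjoint. Four runs are told apart by
-- the second code, 0 in `four₁` and positive in `four₂`.
kind : List ℕ → Fin 6
kind (_ ∷ [])                 = 0F
kind (_ ∷ _ ∷ [])             = 1F
kind (_ ∷ _ ∷ _ ∷ [])         = 2F
kind (_ ∷ zero ∷ _ ∷ _ ∷ [])  = 3F
kind (_ ∷ suc _ ∷ _ ∷ _ ∷ []) = 4F
kind _                        = 5F

size : List ℕ → ℕ
size []       = 0
size (a ∷ as) = suc a + size as

length-decode : ∀ {x y : A} as → length (decode x y as) ≡ size as
length-decode []       = refl
length-decode (a ∷ as) = trans (length-++ (replicate (suc a) _))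
  (cong₂ _+_ (length-replicate (suc a)) (length-decode as))

size-replicate : ∀ n → size (replicate n 0) ≡ n
size-replicate zero    = refl
size-replicate (suc n) = cong suc (size-replicate n)

codesOf-unique : ∀ n i → Unique (codesOf n i)
codesOf-unique n 0F = [] ∷ []
codesOf-unique n 1F = Unique.map⁺ (λ { refl → refl }) (unique pairs (3 + n))
codesOf-unique n 2F = Unique.map⁺ (λ { refl → refl }) (unique triples (2 + n))
codesOf-unique n 3F = Unique.map⁺ (λ { refl → refl }) (unique pairs (1 + n))
codesOf-unique n 4F = Unique.map⁺ (λ { refl → refl }) (unique quadruples (1 + n))
codesOf-unique n 5F = [] ∷ []

size₂ : ∀ a b → 1 + a + (1 + b + 0) ≡ 2 + (a + b)
size₂ = solve-∀

size₃ : ∀ a b c → 1 + a + (1 + b + (1 + c + 0)) ≡ 3 + (a + (b + c))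
size₃ = solve-∀

size₄ : ∀ a b c d → 1 + a + (1 + b + (1 + c + (1 + d + 0))) ≡ 4 + ((a + c) + (d + b))
size₄ = solve-∀

size₄₁ : ∀ a d → 1 + a + (1 + (1 + (1 + d + 0))) ≡ 4 + (a + d)
size₄₁ = solve-∀

∈-codesOf⁻ : ∀ n i {as} → as ∈ codesOf n i → kind as ≡ i × Good as × size as ≡ 5 + n
∈-codesOf⁻ n 0F (here refl) = refl , one _ , cong (5 +_) (+-identityʳ n)
∈-codesOf⁻ n 1F as∈ with (a , b) , ab∈ , refl ← ∈-map⁻ pairCode₂ as∈
  with _ , sum ← sound pairs (3 + n) ab∈ = refl , two a b , trans (size₂ a b) (cong (2 +_) sum)
∈-codesOf⁻ n 2F as∈ with (a , _ , c) , abc∈ , refl ← ∈-map⁻ tripleCode as∈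
  with (_ , (h , refl) , _) , sum ← sound triples (2 + n) abc∈ =
  refl , three a h c , trans (size₃ a (h + h) c) (cong (3 +_) sum)
∈-codesOf⁻ n 3F as∈ with (a , d) , ad∈ , refl ← ∈-map⁻ pairCode₄ as∈
  with _ , sum ← sound pairs (1 + n) ad∈ = refl , four₁ a d , trans (size₄₁ a d) (cong (4 +_) sum)
∈-codesOf⁻ n 4F as∈ with ((a , _) , (d , _)) , x∈ , refl ← ∈-map⁻ quadrupleCode as∈
  with ((a<2l , l , refl) , (d<2h , suc h , refl)) , sum ← sound quadruples (1 + n) x∈ =
  refl , four₂ (suc h) l a<2l d<2h , trans (size₄ a (suc h + suc h) (l + l) d) (cong (4 +_) sum)
∈-codesOf⁻ n 5F (here refl) = refl , alt (5 + n) , size-replicate (5 + n)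

∈-codesOf⁺ : ∀ n {as} → Good as → size as ≡ 5 + n → ∃ λ i → as ∈ codesOf n i
∈-codesOf⁺ n (one a) eq
  with refl ← suc-injective (trans (cong suc (sym (+-identityʳ a))) eq) = 0F , here refl
∈-codesOf⁺ n (two a b) eq = 1F , ∈-map⁺ pairCode₂
  (subst (λ k → (a , b) ∈ list pairs k) (+-cancelˡ-≡ 2 _ _ (trans (sym (size₂ a b)) eq))
    (complete pairs _))
∈-codesOf⁺ n (three a h c) eq = 2F , ∈-map⁺ tripleCode
  (subst (λ k → (a , h + h , c) ∈ list triples k) (+-cancelˡ-≡ 3 _ _ (trans (sym (size₃ a (h + h) c)) eq))
    (complete triples (tt , (h , refl) , tt)))
∈-codesOf⁺ n (four₁ a d) eq = 3F , ∈-map⁺ pairCode₄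
  (subst (λ k → (a , d) ∈ list pairs k) (+-cancelˡ-≡ 4 _ _ (trans (sym (size₄₁ a d)) eq))
    (complete pairs _))
∈-codesOf⁺ n (four₂ {a} {d} h l a<2l d<2h) eq = 4F , ∈-map⁺ quadrupleCode
  (subst (λ k → ((a , l + l) , (d , h + h)) ∈ list quadruples k)
    (+-cancelˡ-≡ 4 _ _ (trans (sym (size₄ a (h + h) (l + l) d)) eq))
    (complete quadruples ((a<2l , l , refl) , (d<2h , h , refl))))
∈-codesOf⁺ n (alt k) eq with refl ← trans (sym (size-replicate k)) eq = 5F , here refl

concatMap-unique : ∀ {k} (f : Fin k → List A) (tag : A → Fin k) → (∀ i → Unique (f i)) →
                   (∀ i {x} → x ∈ f i → tag x ≡ i) → Unique (concatMap f (allFin k))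
concatMap-unique {k = k} f tag unique tagged = Unique.concat⁺
  (All.map⁺ (All.universal unique (allFin k)))
  (AllPairs.map⁺ (AllPairs.map
    (λ i≢j {_} (x∈ , x∈′) → i≢j (trans (sym (tagged _ x∈)) (tagged _ x∈′))) (Unique.allFin⁺ k)))

codes : ℕ → List (List ℕ)
codes n = concatMap (codesOf n) (allFin 6)

codes-unique : ∀ n → Unique (codes n)
codes-unique n = concatMap-unique (codesOf n) kind (codesOf-unique n) (λ i → proj₁ ∘ ∈-codesOf⁻ n i)

∈-codes⁻ : ∀ n {as} → as ∈ codes n → Good as × size as ≡ 5 + n
∈-codes⁻ n as∈ with i , _ , as∈′ ← find (∈-concatMap⁻ (codesOf n) {xs = allFin 6} as∈) =
  proj₂ (∈-codesOf⁻ n i as∈′)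

∈-codes⁺ : ∀ n {as} → Good as → size as ≡ 5 + n → as ∈ codes n
∈-codes⁺ n g eq with i , as∈ ← ∈-codesOf⁺ n g eq = ∈-concatMap⁺ (codesOf n) (lose (∈-allFin i) as∈)

goodWords : ℕ → List BinaryWord
goodWords n = map (decode 0F 1F) (codes n) ++ map (decode 1F 0F) (codes n)

∈-decoded-head : ∀ n (x y : Fin 2) {w} → w ∈ map (decode x y) (codes n) → ∃ λ v → w ≡ x ∷ v
∈-decoded-head n x y w∈ with ∈-map⁻ (decode x y) w∈
... | []     , as∈ , _    = contradiction (proj₂ (∈-codes⁻ n as∈)) λ ()
... | a ∷ as , _   , refl = _ , refl

goodWords-unique : ∀ n → Unique (goodWords n)
goodWords-unique n = Unique.++⁺
  (Unique.map⁺ (decode-injective (λ ()) _ _) (codes-unique n))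
  (Unique.map⁺ (decode-injective (λ ()) _ _) (codes-unique n))
  disjoint
  where
  disjoint : ∀ {w : BinaryWord} → ¬ (w ∈ map (decode 0F 1F) (codes n) × w ∈ map (decode 1F 0F) (codes n))
  disjoint (w∈₀ , w∈₁)
    with _ , refl ← ∈-decoded-head n 0F 1F w∈₀ with _ , () ← ∈-decoded-head n 1F 0F w∈₁

∈-goodWords⁻ : ∀ n {w} → w ∈ goodWords n → GoodWord w × length w ≡ 5 + n
∈-goodWords⁻ n w∈ with ∈-++⁻ (map (decode 0F 1F) (codes n)) w∈
... | inj₁ w∈₀ with as , as∈ , refl ← ∈-map⁻ (decode 0F 1F) w∈₀ with g , sz ← ∈-codes⁻ n as∈ =
  (_ , _ , (λ ()) , as , g , refl) , trans (length-decode as) sz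
... | inj₂ w∈₁ with as , as∈ , refl ← ∈-map⁻ (decode 1F 0F) w∈₁ with g , sz ← ∈-codes⁻ n as∈ =
  (_ , _ , (λ ()) , as , g , refl) , trans (length-decode as) sz

∈-goodWords⁺ : ∀ n {w} → GoodWord w → length w ≡ 5 + n → w ∈ goodWords n
∈-goodWords⁺ n (0F , 0F , x≢y , _) len = contradiction refl x≢y
∈-goodWords⁺ n (1F , 1F , x≢y , _) len = contradiction refl x≢y
∈-goodWords⁺ n (0F , 1F , _ , as , g , refl) len =
  ∈-++⁺ˡ (∈-map⁺ _ (∈-codes⁺ n g (trans (sym (length-decode as)) len)))
∈-goodWords⁺ n (1F , 0F , _ , as , g , refl) len =
  ∈-++⁺ʳ (map (decode 0F 1F) (codes n)) (∈-map⁺ _ (∈-codes⁺ n g (trans (sym (length-decode as)) len)))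

-- Two lists without repetitions and with the same members are permutations of each other.
m-goodWords : ∀ n → m (5 + n) ≡ length (goodWords n)
m-goodWords n = ↭-length (∼bag⇒↭ (unique∧set⇒bag
  (Unique.filter⁺ avoids? (words-unique (5 + n))) (goodWords-unique n) (mk⇔ to from)))
  where
  avoids? = avoidsMesosomes? Fin._≟_
  to : ∀ {w} → w ∈ filter avoids? (words (5 + n)) → w ∈ goodWords n
  to {w} w∈ with w∈words , av ← ∈-filter⁻ avoids? {xs = words (5 + n)} w∈ =
    ∈-goodWords⁺ n (avoids⇒good w av) (∈-words⁻ (5 + n) w∈words)
  from : ∀ {w} → w ∈ goodWords n → w ∈ filter avoids? (words (5 + n))
  from {w} w∈ with g , len ← ∈-goodWords⁻ n w∈ =
    ∈-filter⁺ avoids? (subst (λ k → w ∈ words k) len (∈-words⁺ w)) (good⇒avoids g)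

-- Counting

evenCount : ℕ → ℕ
evenCount zero          = 1
evenCount (suc zero)    = 0
evenCount (suc (suc k)) = evenCount k

length-evensOf : ∀ k → length (evensOf k) ≡ evenCount k
length-evensOf zero          = refl
length-evensOf (suc zero)    = refl
length-evensOf (suc (suc k)) = trans (length-map (2 +_) (evensOf k)) (length-evensOf k)

-- This is `floor ((s + 2) / 4)`: `shift` raises the sum by four, and each sum from two on has one
-- new corner.
cornerCount : ℕ → ℕ
cornerCount 0 = 0
cornerCount 1 = 0
cornerCount 2 = 1
cornerCount 3 = 1
cornerCount (suc (suc (suc (suc s)))) = suc (cornerCount s)

length-cornersOf : ∀ s → length (cornersOf s) ≡ cornerCount s
length-cornersOf 0 = refl
length-cornersOf 1 = refl
length-cornersOf 2 = refl
length-cornersOf 3 = refl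
length-cornersOf (suc (suc (suc (suc s)))) =
  cong suc (trans (length-map shift (cornersOf s)) (length-cornersOf s))

-- Convolving with `const 1` takes partial sums. In `tripleCount` the two outer runs supply two such
-- factors and the middle run `evenCount`.
evensUpTo tripleCount cornersUpTo quadrupleCount : ℕ → ℕ
evensUpTo      = convolution evenCount (const 1)
tripleCount    = convolution (const 1) evensUpTo
cornersUpTo    = convolution (const 1) cornerCount
quadrupleCount = convolution cornerCount cornerCount

length-pairs : ∀ k → length (list pairs k) ≡ suc k
length-pairs k = trans (length-⊛ [_] [_] k) (ones k)
  where
  ones : ∀ k → convolution (const 1) (const 1) k ≡ suc k
  ones zero    = refl
  ones (suc k) = cong suc (ones k)

length-triples : ∀ k → length (list triples k) ≡ tripleCount k
length-triples k = trans (length-⊛ [_] (list (product evens naturals)) k)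
  (convolution-cong (λ _ → refl)
    (λ j → trans (length-⊛ evensOf [_] j) (convolution-cong length-evensOf (λ _ → refl) j)) k)

length-quadruples : ∀ k → length (list quadruples k) ≡ quadrupleCount k
length-quadruples k = trans (length-⊛ cornersOf cornersOf k)
  (convolution-cong length-cornersOf length-cornersOf k)

codeCount : ℕ → ℕ
codeCount n = 1 + (4 + n + (tripleCount (2 + n) + (2 + n + (quadrupleCount (1 + n) + 1))))

length-map-++ : ∀ (f : A → B) xs {ys j k} →
                length xs ≡ j → length ys ≡ k → length (map f xs ++ ys) ≡ j + k
length-map-++ f xs lxs lys = trans (length-++ (map f xs)) (cong₂ _+_ (trans (length-map f xs) lxs) lys)

length-codes : ∀ n → length (codes n) ≡ codeCount n
length-codes n = cong suc
  (length-map-++ pairCode₂ (list pairs (3 + n)) (length-pairs (3 + n))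
  (length-map-++ tripleCode (list triples (2 + n)) (length-triples (2 + n))
  (length-map-++ pairCode₄ (list pairs (1 + n)) (length-pairs (1 + n))
  (length-map-++ quadrupleCode (list quadruples (1 + n)) (length-quadruples (1 + n)) refl))))

m-codeCount : ∀ n → m (5 + n) ≡ codeCount n + codeCount n
m-codeCount n = trans (m-goodWords n)
  (length-map-++ (decode 0F 1F) (codes n) (length-codes n)
    (trans (length-map (decode 1F 0F) (codes n)) (length-codes n)))

-- Recurrences and closed forms

convolution-suc : ∀ f g k → convolution (suc ∘ f) g k ≡ convolution (const 1) g k + convolution f g k
convolution-suc f g zero    = cong (_+ f 0 * g 0) (sym (+-identityʳ (g 0)))
convolution-suc f g (suc k) = trans
  (cong (suc (f 0) * g (suc k) +_) (convolution-suc (f ∘ suc) g k))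
  (rearrange (f 0) (g (suc k)) (convolution (const 1) g k) (convolution (f ∘ suc) g k))
  where
  rearrange : ∀ a b c d → (1 + a) * b + (c + d) ≡ (1 * b + c) + (a * b + d)
  rearrange = solve-∀

-- The values of `cornerCount` at 0 to 3 add up to two, and each of the other `k + 1` terms exceeds
-- the one four places earlier by one.
cornersUpTo-4+ : ∀ k → cornersUpTo (4 + k) ≡ 3 + k + cornersUpTo k
cornersUpTo-4+ zero    = refl
cornersUpTo-4+ (suc k) = trans
  (cong (1 * cornerCount (5 + k) +_) (cornersUpTo-4+ k))
  (rearrange (cornerCount (1 + k)) k (cornersUpTo k))
  where
  rearrange : ∀ c k s → 1 * (1 + c) + (3 + k + s) ≡ 3 + (1 + k) + (1 * c + s)
  rearrange = solve-∀

-- For the generating function `C` of `cornerCount` this is `(1 - x^4) C = x^2 / (1 - x)`,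
-- multiplied by `C`. The values 1 at 2 and 3 give the first two terms, and `convolution-suc` gives
-- the rest.
quadrupleCount-4+ : ∀ k → quadrupleCount (4 + k) ≡ cornersUpTo (2 + k) + quadrupleCount k
quadrupleCount-4+ k = trans
  (cong (λ s → 1 * cornerCount (2 + k) + (1 * cornerCount (1 + k) + s)) (convolution-suc cornerCount cornerCount k))
  (rearrange (cornerCount (2 + k)) (cornerCount (1 + k)) (cornersUpTo k) (quadrupleCount k))
  where
  rearrange : ∀ a b c d → 1 * a + (1 * b + (c + d)) ≡ (1 * a + (1 * b + c)) + d
  rearrange = solve-∀

-- `evensUpTo (2 + k)` computes to `suc (evensUpTo k)`, so the sum of neighbours grows by one.
evensUpTo-sum : ∀ k → evensUpTo (1 + k) + evensUpTo k ≡ 2 + k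
evensUpTo-sum zero    = refl
evensUpTo-sum (suc k) = cong suc (trans (+-comm (evensUpTo k) (evensUpTo (1 + k))) (evensUpTo-sum k))

tripleCount-2+ : ∀ k → tripleCount (2 + k) ≡ 3 + k + tripleCount k
tripleCount-2+ k = trans
  (rearrange (evensUpTo (2 + k)) (evensUpTo (1 + k)) (tripleCount k))
  (cong (_+ tripleCount k) (evensUpTo-sum (1 + k)))
  where
  rearrange : ∀ a b c → 1 * a + (1 * b + c) ≡ (a + b) + c
  rearrange = solve-∀

-- The growth of `codeCount` over four steps: 4 from each of the two kinds indexed by pairs,
-- `12 + 2 * n` from three runs, and the partial sum from quadruples.
increment : ℕ → ℕ
increment n = 20 + 2 * n + cornersUpTo (3 + n)

codeCount-4+ : ∀ n → codeCount (4 + n) ≡ increment n + codeCount n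
codeCount-4+ n = begin
  codeCount (4 + n)
    ≡⟨ cong₂ (λ t q → 1 + (4 + (4 + n) + (t + (2 + (4 + n) + (q + 1)))))
         (trans (tripleCount-2+ (4 + n)) (cong (3 + (4 + n) +_) (tripleCount-2+ (2 + n))))
         (quadrupleCount-4+ (1 + n)) ⟩
  1 + (4 + (4 + n) + ((3 + (4 + n) + (3 + (2 + n) + tripleCount (2 + n))) +
    (2 + (4 + n) + ((cornersUpTo (3 + n) + quadrupleCount (1 + n)) + 1))))
    ≡⟨ rearrange n (tripleCount (2 + n)) (cornersUpTo (3 + n)) (quadrupleCount (1 + n)) ⟩
  increment n + codeCount n ∎
  where
  rearrange : ∀ n t c q →
    1 + (4 + (4 + n) + ((3 + (4 + n) + (3 + (2 + n) + t)) + (2 + (4 + n) + ((c + q) + 1)))) ≡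
    20 + 2 * n + c + (1 + (4 + n + (t + (2 + n + (q + 1)))))
  rearrange = solve-∀

increment-4+ : ∀ n → increment (4 + n) ≡ 14 + n + increment n
increment-4+ n = trans
  (cong (20 + 2 * (4 + n) +_) (cornersUpTo-4+ (3 + n)))
  (rearrange n (cornersUpTo (3 + n)))
  where
  rearrange : ∀ n c → 20 + 2 * (4 + n) + (3 + (3 + n) + c) ≡ 14 + n + (20 + 2 * n + c)
  rearrange = solve-∀

-- Sums the steps `14 + i + 4 * t` over `t < j`. The index is `j * 4 + i` because at `suc j` it then
-- computes to four successors.
increment-closed : ∀ i j → increment (j * 4 + i) ≡ 2 * j * j + (12 + i) * j + increment i
increment-closed i zero    = cong (_+ increment i) (sym (*-zeroʳ (12 + i)))
increment-closed i (suc j) = trans (increment-4+ (j * 4 + i))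
  (trans (cong (14 + (j * 4 + i) +_) (increment-closed i j)) (rearrange i j (increment i)))
  where
  rearrange : ∀ i j d → 14 + (j * 4 + i) + (2 * j * j + (12 + i) * j + d) ≡
                        2 * (1 + j) * (1 + j) + (12 + i) * (1 + j) + d
  rearrange = solve-∀

-- The negative term of the cubic is moved to the left, since subtraction on ℕ truncates.
codeCount-closed : ∀ i j →
  3 * (codeCount (j * 4 + i) + codeCount (j * 4 + i)) + (34 + 3 * i) * j ≡
  4 * j * j * j + (30 + 3 * i) * j * j + 6 * increment i * j + 3 * (codeCount i + codeCount i)
codeCount-closed i zero    = base i (codeCount i) (increment i)
  where
  base : ∀ i h d → 3 * (h + h) + (34 + 3 * i) * 0 ≡
                   4 * 0 * 0 * 0 + (30 + 3 * i) * 0 * 0 + 6 * d * 0 + 3 * (h + h)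
  base = solve-∀
codeCount-closed i (suc j) = begin
  3 * (codeCount (4 + n) + codeCount (4 + n)) + (34 + 3 * i) * suc j
    ≡⟨ cong (λ h → 3 * (h + h) + (34 + 3 * i) * suc j)
         (trans (codeCount-4+ n) (cong (_+ codeCount n) (increment-closed i j))) ⟩
  3 * ((2 * j * j + (12 + i) * j + increment i + codeCount n) +
       (2 * j * j + (12 + i) * j + increment i + codeCount n)) + (34 + 3 * i) * suc j
    ≡⟨ isolate i j (increment i) (codeCount n) ⟩
  (3 * (codeCount n + codeCount n) + (34 + 3 * i) * j) +
  (6 * (2 * j * j + (12 + i) * j + increment i) + (34 + 3 * i))
    ≡⟨ cong (_+ (6 * (2 * j * j + (12 + i) * j + increment i) + (34 + 3 * i))) (codeCount-closed i j) ⟩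
  (4 * j * j * j + (30 + 3 * i) * j * j + 6 * increment i * j + 3 * (codeCount i + codeCount i)) +
  (6 * (2 * j * j + (12 + i) * j + increment i) + (34 + 3 * i))
    ≡⟨ collect i j (increment i) (codeCount i) ⟩
  _ ∎
  where
  n : ℕ
  n = j * 4 + i
  isolate : ∀ i j d h →
    3 * ((2 * j * j + (12 + i) * j + d + h) + (2 * j * j + (12 + i) * j + d + h)) + (34 + 3 * i) * (1 + j) ≡
    (3 * (h + h) + (34 + 3 * i) * j) + (6 * (2 * j * j + (12 + i) * j + d) + (34 + 3 * i))
  isolate = solve-∀
  collect : ∀ i j d h →
    (4 * j * j * j + (30 + 3 * i) * j * j + 6 * d * j + 3 * (h + h)) +
    (6 * (2 * j * j + (12 + i) * j + d) + (34 + 3 * i)) ≡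
    4 * (1 + j) * (1 + j) * (1 + j) + (30 + 3 * i) * (1 + j) * (1 + j) + 6 * d * (1 + j) + 3 * (h + h)
  collect = solve-∀

-- `j` and `i` are quotient and remainder of `n - 5` by 4 in every use, and `q` is the desired
-- cubic. The correction `(34 + 3 * i) * j` is added to both sides and cancelled.
m-closed : ∀ i j {n} q → n ≡ 5 + (j * 4 + i) →
  4 * j * j * j + (30 + 3 * i) * j * j + 6 * increment i * j + 3 * (codeCount i + codeCount i) ≡ q + (34 + 3 * i) * j →
  m n * 3 ≡ q
m-closed i j q refl eq = +-cancelʳ-≡ ((34 + 3 * i) * j) (m (5 + (j * 4 + i)) * 3) q (begin
  m (5 + (j * 4 + i)) * 3 + (34 + 3 * i) * j
    ≡⟨ cong (_+ (34 + 3 * i) * j) (*-comm (m (5 + (j * 4 + i))) 3) ⟩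
  3 * m (5 + (j * 4 + i)) + (34 + 3 * i) * j
    ≡⟨ cong (λ h → 3 * h + (34 + 3 * i) * j) (m-codeCount (j * 4 + i)) ⟩
  3 * (codeCount (j * 4 + i) + codeCount (j * 4 + i)) + (34 + 3 * i) * j
    ≡⟨ trans (codeCount-closed i j) eq ⟩
  q + (34 + 3 * i) * j ∎)

-- The ring solver does not interpret _^_ on ℕ, hence the unfolded powers below.
m-4k : ∀ k → 5 ≤ 4 * k → m (4 * k) * 3 + 12 ≡ 4 * k ^ 3 + 15 * k ^ 2 + 41 * k
m-4k 1 (s≤s (s≤s (s≤s (s≤s ()))))
m-4k (suc (suc j)) _ = trans
  (cong (_+ 12) (m-closed 3 j (4 * j * j * j + 39 * j * j + 149 * j + 162) (index j) (poly j))) (+12 j)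
  where
  index : ∀ j → 4 * (2 + j) ≡ 5 + (j * 4 + 3)
  index = solve-∀
  poly : ∀ j → 4 * j * j * j + 39 * j * j + 192 * j + 162 ≡
               4 * j * j * j + 39 * j * j + 149 * j + 162 + 43 * j
  poly = solve-∀
  +12 : ∀ j → 4 * j * j * j + 39 * j * j + 149 * j + 162 + 12 ≡
              4 * ((2 + j) * ((2 + j) * ((2 + j) * 1))) + 15 * ((2 + j) * ((2 + j) * 1)) + 41 * (2 + j)
  +12 = solve-∀

m-4k+1 : ∀ k → 5 ≤ 4 * k + 1 → m (4 * k + 1) * 3 ≡ 4 * k ^ 3 + 18 * k ^ 2 + 50 * k
m-4k+1 zero (s≤s ())
m-4k+1 (suc j) _ = m-closed 0 j _ (index j) (poly j)
  where
  index : ∀ j → 4 * (1 + j) + 1 ≡ 5 + (j * 4 + 0)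
  index = solve-∀
  -- Evaluation gives 132 for `6 * increment 0` and 72 for `3 * (codeCount 0 + codeCount 0)`; the
  -- next two cases do the same for `i` equal to 1 and 2.
  poly : ∀ j → 4 * j * j * j + 30 * j * j + 132 * j + 72 ≡
               4 * ((1 + j) * ((1 + j) * ((1 + j) * 1))) + 18 * ((1 + j) * ((1 + j) * 1)) + 50 * (1 + j) + 34 * j
  poly = solve-∀

m-4k+2 : ∀ k → 5 ≤ 4 * k + 2 → m (4 * k + 2) * 3 ≡ 4 * k ^ 3 + 21 * k ^ 2 + 59 * k + 12
m-4k+2 zero (s≤s (s≤s ()))
m-4k+2 (suc j) _ = m-closed 1 j _ (index j) (poly j)
  where
  index : ∀ j → 4 * (1 + j) + 2 ≡ 5 + (j * 4 + 1)
  index = solve-∀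
  poly : ∀ j → 4 * j * j * j + 33 * j * j + 150 * j + 96 ≡
               4 * ((1 + j) * ((1 + j) * ((1 + j) * 1))) + 21 * ((1 + j) * ((1 + j) * 1)) + 59 * (1 + j) + 12 + 37 * j
  poly = solve-∀

m-4k+3 : ∀ k → 5 ≤ 4 * k + 3 → m (4 * k + 3) * 3 ≡ 4 * k ^ 3 + 24 * k ^ 2 + 68 * k + 30
m-4k+3 zero (s≤s (s≤s (s≤s ())))
m-4k+3 (suc j) _ = m-closed 2 j _ (index j) (poly j)
  where
  index : ∀ j → 4 * (1 + j) + 3 ≡ 5 + (j * 4 + 2)
  index = solve-∀
  poly : ∀ j → 4 * j * j * j + 36 * j * j + 168 * j + 126 ≡
               4 * ((1 + j) * ((1 + j) * ((1 + j) * 1))) + 24 * ((1 + j) * ((1 + j) * 1)) + 68 * (1 + j) + 30 + 40 * j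
  poly = solve-∀

-- Opened only here, because +_ makes sections such as (2 +_) ambiguous.
open import Data.Integer.Base using (+_; _-_)
import Data.Integer.Base as ℤ
import Data.Integer.Properties as ℤ
open import Data.Rational.Base using (_/_)
open import Data.Rational.Properties using (fromℚᵘ-cong)
open import Data.Rational.Unnormalised.Base using (mkℚᵘ; *≡*)

-- Cross-multiplication of unnormalised fractions, carried over to reduced ones. `mkℚᵘ` takes the
-- denominator minus one, so `0` and `2` stand for 1 and 3.
over-3 : ∀ n i → + n ℤ.* + 3 ≡ i → (+ n) / 1 ≡ i / 3
over-3 n i eq = fromℚᵘ-cong {mkℚᵘ (+ n) 0} {mkℚᵘ i 2} (*≡* (trans eq (sym (ℤ.*-identityʳ i))))

over-3-ℕ : ∀ n {q} → n * 3 ≡ q → (+ n) / 1 ≡ (+ q) / 3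
over-3-ℕ n {q} eq = over-3 n (+ q) (trans (sym (ℤ.pos-* n 3)) (cong +_ eq))

-- The 12 is subtracted in the integers; the truncated `∸` in the calculation is exact because the
-- minuend is `n * 3 + 12`.
over-3-∸ : ∀ n {q} → n * 3 + 12 ≡ q → (+ n) / 1 ≡ (+ q - + 12) / 3
over-3-∸ n {q} refl = over-3 n (+ q - + 12) (begin
  + n ℤ.* + 3           ≡⟨ ℤ.pos-* n 3 ⟨
  + (n * 3)             ≡⟨ cong +_ (m+n∸n≡m (n * 3) 12) ⟨
  + (n * 3 + 12 ∸ 12)   ≡⟨ ℤ.⊖-≥ (m≤n+m 12 (n * 3)) ⟨
  (n * 3 + 12) ℤ.⊖ 12   ≡⟨ ℤ.m-n≡m⊖n (n * 3 + 12) 12 ⟨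
  + (n * 3 + 12) - + 12 ∎)

theorem2 : (k : ℕ) →
    (5 ≤ 4 * k →
    (+ m (4 * k)) / 1 ≡ (+ (4 * k ^ 3 + 15 * k ^ 2 + 41 * k) - + 12) / 3) ×
    (5 ≤ 4 * k + 1 →
    (+ m (4 * k + 1)) / 1 ≡ (+ (4 * k ^ 3 + 18 * k ^ 2 + 50 * k)) / 3) ×
    (5 ≤ 4 * k + 2 →
    (+ m (4 * k + 2)) / 1 ≡ (+ (4 * k ^ 3 + 21 * k ^ 2 + 59 * k + 12)) / 3) ×
    (5 ≤ 4 * k + 3 →
    (+ m (4 * k + 3)) / 1 ≡ (+ (4 * k ^ 3 + 24 * k ^ 2 + 68 * k + 30)) / 3)
theorem2 k =
  (λ 5≤ → over-3-∸ (m (4 * k))     (m-4k k 5≤)) ,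
  (λ 5≤ → over-3-ℕ (m (4 * k + 1)) (m-4k+1 k 5≤)) ,
  (λ 5≤ → over-3-ℕ (m (4 * k + 2)) (m-4k+2 k 5≤)) ,
  (λ 5≤ → over-3-ℕ (m (4 * k + 3)) (m-4k+3 k 5≤))
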